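{- Let $k$ be an even positive integer. Then $\mathcal{G}(\mathcal{P}_{1,0}(3k,k))=0$.
   Context: Toggle: Let $G$ be a finite simple graph, with $N[v]$ the closed neighborhood of $v$. A position $\{G,V_0\}$ consists of $G$ and a set $V_0\subseteq V(G)$ of vertices of weight $0$; all other vertices have weight $1$. Let $\sigma(v)$ be the sum of the weights of the vertices in $N[v]$. A legal move consists of choosing a vertex $v$ of weight $1$ and switching the weight ($0\leftrightarrow 1$) of every vertex of $N[v]$; it is allowed only if $\sigma(v)$ after the switch is strictly smaller than $\sigma(v)$ before it. Two players alternate legal moves; a player with no legal move loses. Nimbers: $\mathcal{G}(\mathcal{S})=\mathrm{mex}\{\mathcal{G}(\mathcal{S}') : \mathcal{S}' \text{ reachable from } \mathcal{S} \text{ by one legal move}\}$, where $\mathrm{mex}(T)$ is the least nonnegative integer not in the finite set $T$ (so $\mathrm{mex}(\emptyset)=0$). The generalized Petersen graph $P(m,k)$ has inner vertices $v_{0,1},\dots,v_{0,m}$ and outer vertices $v_{1,1},\dots,v_{1,m}$ (second indices modulo $m$), with edges $v_{1,i}v_{1,i+1}$, $v_{0,i}v_{0,i+k}$ and $v_{0,i}v_{1,i}$ for all $i$. $\mathcal{P}_{1,0}(m,k)$ is the position on $P(m,k)$ in which all inner vertices have weight $1$ and all outer vertices have weight $0$. -}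

module Defs where

open import Data.Bool.Base using (Bool; true; false; not; if_then_else_)
open import Data.Empty using (⊥)
open import Data.Fin.Base using (Fin; zero; suc; toℕ)
import Data.Fin.Properties as Fin
open import Data.List.Base using (List; []; _∷_; map; filter; allFin; cartesianProduct)
open import Data.List.Extrema.Nat using (max; xs≤max)
open import Data.List.Membership.Propositional using (_∈_; _∉_)
open import Data.List.Membership.Propositional.Properties using (∈-allFin; ∈-cartesianProduct⁺)
open import Data.List.Relation.Unary.All as All using ()
open import Data.List.Relation.Unary.All.Properties using (all-filter)
open import Data.List.Relation.Unary.Unique.Propositional using (Unique)
open import Data.List.Relation.Unary.Unique.Propositional.Properties using (allFin⁺; cartesianProduct⁺)
open import Data.Nat.Base using (ℕ; zero; suc; _+_; _<_)
open import Data.Nat.DivMod using (_mod_)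
open import Data.Nat.Induction using (<-wellFounded)
open import Data.Nat.ListAction using (sum)
open import Data.Nat.Properties
  using (_≟_; _<?_; m<1+n⇒m<n∨m≡n; n<1+n; n≮n; +-assoc; +-cancelʳ-<; +-monoʳ-<)
open import Data.Nat.Tactic.RingSolver using (solve-∀)
open import Data.Product.Base using (∃; _×_; _,_; proj₁)
open import Data.Product.Properties using (≡-dec)
open import Data.Sum.Base as Sum using (_⊎_; inj₁; inj₂)
open import Function.Base using (_∘_)
open import Induction.WellFounded using (Acc; acc; WellFounded; module Subrelation)
open import Level using (0ℓ)
open import Relation.Binary.Construct.On using () renaming (wellFounded to on-wellFounded)
open import Relation.Binary.Core using (Rel)
open import Relation.Binary.Definitions using (Decidable; DecidableEquality; Irreflexive; Symmetric)
open import Relation.Binary.PropositionalEquality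
  using (_≡_; _≢_; refl; sym; trans; cong; subst)
open import Relation.Nullary using (¬_; Dec; yes; no; does; contradiction)
open import Relation.Nullary.Decidable using (_×-dec_; _⊎-dec_; ¬?; dec-false)
import Relation.Unary as U

import Data.List.Membership.DecPropositional as DecMembership
open DecMembership _≟_ using () renaming (_∈?_ to _∈ℕ?_)

IsMex : List ℕ → ℕ → Set
IsMex T n = n ∉ T × (∀ {m} → m < n → m ∈ T)

mex-below : ∀ T b → ∃ (IsMex T) ⊎ (∀ {m} → m < b → m ∈ T)
mex-below T zero = inj₂ λ ()
mex-below T (suc b) with mex-below T b
... | inj₁ found = inj₁ found
... | inj₂ below with b ∈ℕ? T
...   | no b∉T = inj₁ (b , b∉T , below)
...   | yes b∈T = inj₂ λ m<1+b → Sum.[ below , (λ { refl → b∈T }) ] (m<1+n⇒m<n∨m≡n m<1+b)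

mex-exists : ∀ T → ∃ (IsMex T)
mex-exists T with mex-below T (suc (suc (max 0 T)))
... | inj₁ found = found
... | inj₂ below =
  contradiction (All.lookup (xs≤max 0 T) (below (n<1+n _))) (n≮n _)

mex : List ℕ → ℕ
mex T = proj₁ (mex-exists T)

record Graph : Set₁ where
  field
    Vertex   : Set
    _≟ᵥ_     : DecidableEquality Vertex
    vertices : List Vertex
    complete : ∀ v → v ∈ vertices
    unique   : Unique vertices
    Adj      : Rel Vertex 0ℓ
    adj?     : Decidable Adj
    adj-sym  : Symmetric Adj
    adj-irr  : Irreflexive _≡_ Adj

module Toggle (G : Graph) where
  open Graph G

  -- The position {G , V₀}, given by the indicator function of V₀:
  -- true marks a vertex of weight 0.
  Position : Set
  Position = Vertex → Bool

  weight : Position → Vertex → ℕ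
  weight V₀ v = if V₀ v then 0 else 1

  _∈N[_] : Vertex → Vertex → Set
  u ∈N[ v ] = u ≡ v ⊎ Adj v u

  _∈N[_]? : ∀ u v → Dec (u ∈N[ v ])
  u ∈N[ v ]? = (u ≟ᵥ v) ⊎-dec adj? v u

  N[_] : Vertex → List Vertex
  N[ v ] = filter (_∈N[ v ]?) vertices

  σ : Position → Vertex → ℕ
  σ V₀ v = sum (map (weight V₀) N[ v ])

  switch : Position → Vertex → Position
  switch V₀ v u = if does (u ∈N[ v ]?) then not (V₀ u) else V₀ u

  Legal : Position → Vertex → Set
  Legal V₀ v = weight V₀ v ≡ 1 × σ (switch V₀ v) v < σ V₀ v

  legal? : ∀ V₀ → U.Decidable (Legal V₀)
  legal? V₀ v = (weight V₀ v ≟ 1) ×-dec (σ (switch V₀ v) v <? σ V₀ v)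

  -- S′ ≺ S: the position S′ is reachable from S by one legal move.
  data _≺_ : Rel Position 0ℓ where
    move : ∀ {S v} → Legal S v → switch S v ≺ S

  -- Play terminates because every legal move lowers the total weight.
  total : Position → ℕ
  total S = sum (map (weight S) vertices)

  private
    weight-switch-outside : ∀ S v u → ¬ u ∈N[ v ] → weight (switch S v) u ≡ weight S u
    weight-switch-outside S v u u∉N rewrite dec-false (u ∈N[ v ]?) u∉N = refl

    exchange : ∀ (f g : Vertex → ℕ) {P : Vertex → Set} (P? : U.Decidable P) →
               (∀ u → ¬ P u → f u ≡ g u) → ∀ xs →
               sum (map f xs) + sum (map g (filter P? xs)) ≡
               sum (map g xs) + sum (map f (filter P? xs))
    exchange f g P? f≡g [] = refl
    exchange f g P? f≡g (x ∷ xs) with P? x | exchange f g P? f≡g xs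
    ... | yes _  | ih = trans (regroup (f x) (g x) _ _) (trans (cong ((f x + g x) +_) ih) (regroup′ (f x) (g x) _ _))
      where
      regroup : ∀ a b c d → (a + c) + (b + d) ≡ (a + b) + (c + d)
      regroup = solve-∀
      regroup′ : ∀ a b c d → (a + b) + (c + d) ≡ (b + c) + (a + d)
      regroup′ = solve-∀
    ... | no ¬Px | ih rewrite f≡g x ¬Px = trans (+-assoc (g x) _ _) (trans (cong (g x +_) ih) (sym (+-assoc (g x) _ _)))

  ≺⇒total< : ∀ {S′ S} → S′ ≺ S → total S′ < total S
  ≺⇒total< (move {S} {v} (_ , σ<)) = +-cancelʳ-< (σ S v) _ _
    (subst (_< total S + σ S v)
      (sym (exchange (weight (switch S v)) (weight S) (_∈N[ v ]?) (weight-switch-outside S v) vertices))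
      (+-monoʳ-< (total S) σ<))

  ≺-wellFounded : WellFounded _≺_
  ≺-wellFounded = Subrelation.wellFounded ≺⇒total< (on-wellFounded total <-wellFounded)

  nimber-acc : ∀ S → Acc _≺_ S → ℕ
  nimber-acc S (acc rec) =
    mex (All.reduce (λ {v} legal → nimber-acc (switch S v) (rec (move legal)))
                    (all-filter (legal? S) vertices))

  nimber : Position → ℕ
  nimber S = nimber-acc S (≺-wellFounded S)

open Toggle public using (Position; nimber)

-- Indices run over 0, …, m − 1 as representatives modulo m.
_⊕_ : ∀ {m} → Fin m → ℕ → Fin m
_⊕_ {m} i k = (toℕ i + k) mod m
  where instance _ = Fin.nonZeroIndex i

-- (0 , i) is the inner vertex v₀ᵢ and (1 , i) the outer vertex v₁ᵢ.
PVertex : ℕ → Set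
PVertex m = Fin 2 × Fin m

PEdge : ∀ m → ℕ → Rel (PVertex m) 0ℓ
PEdge m k (zero     , i) (zero     , j) = j ≡ i ⊕ k
PEdge m k (zero     , i) (suc zero , j) = j ≡ i
PEdge m k (suc zero , i) (suc zero , j) = j ≡ i ⊕ 1
PEdge m k (suc zero , i) (zero     , j) = ⊥

pEdge? : ∀ m k → Decidable (PEdge m k)
pEdge? m k (zero     , i) (zero     , j) = j Fin.≟ (i ⊕ k)
pEdge? m k (zero     , i) (suc zero , j) = j Fin.≟ i
pEdge? m k (suc zero , i) (suc zero , j) = j Fin.≟ (i ⊕ 1)
pEdge? m k (suc zero , i) (zero     , j) = no λ ()

-- Edges are unordered pairs of distinct vertices. The condition u ≢ v only
-- matters for degenerate parameters (m ∣ k or m = 1), where a loop would arise.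
P : ℕ → ℕ → Graph
P m k = record
  { Vertex   = PVertex m
  ; _≟ᵥ_     = _≟ₚ_
  ; vertices = cartesianProduct (allFin 2) (allFin m)
  ; complete = λ { (a , i) → ∈-cartesianProduct⁺ (∈-allFin a) (∈-allFin i) }
  ; unique   = cartesianProduct⁺ (allFin⁺ 2) (allFin⁺ m)
  ; Adj      = λ u v → u ≢ v × (PEdge m k u v ⊎ PEdge m k v u)
  ; adj?     = λ u v → ¬? (u ≟ₚ v) ×-dec (pEdge? m k u v ⊎-dec pEdge? m k v u)
  ; adj-sym  = λ { (u≢v , e) → u≢v ∘ sym , Sum.swap e }
  ; adj-irr  = λ { u≡v (u≢v , _) → u≢v u≡v }
  }
  where
  _≟ₚ_ : DecidableEquality (PVertex m)
  _≟ₚ_ = ≡-dec Fin._≟_ Fin._≟_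

𝒫₁₀ : ∀ m k → Position (P m k)
𝒫₁₀ m k (zero     , _) = false
𝒫₁₀ m k (suc zero , _) = true

{-# OPTIONS --safe #-}
-- The inner vertices form k triangles, one for each residue modulo k. A triangle is
-- playable until its first move, which turns it off and turns on the outer neighbour of
-- the vertex played. The inner neighbour of an outer vertex i that is on is thus off, so
-- playing i requires both i − 1 and i + 1 to be on. As 3k is even, the outer cycle splits
-- into pairs of consecutive vertices, and one of i ± 1 is the partner of i. When the
-- first player plays the inner vertex i, the second plays the one at partner i + k: this
-- uses up both triangles and never leaves two partners on together. Hence outer moves
-- never become legal, and the triangles run out in pairs.
module Submission where

open import Defs
open import Data.Nat using (ℕ; _*_; _>_)
open import Data.Nat.Divisibility using (_∣_)
open import Relation.Binary.PropositionalEquality using (_≡_)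

open import Data.Bool.Base using (Bool; true; false; not; if_then_else_)
open import Data.Fin.Base using (Fin; zero; suc; toℕ)
open import Data.Fin.Properties using (_≟_; toℕ<n; toℕ-fromℕ<; toℕ-injective)
open import Data.List.Base using (List; []; _∷_; map)
open import Data.List.Membership.Propositional using (_∈_; _∉_)
open import Data.List.Membership.Propositional.Properties using (∈-filter⁺; ∈-filter⁻)
open import Data.List.Membership.Propositional.Properties.WithK using (unique∧set⇒bag)
open import Data.List.Properties using (map-cong-local)
open import Data.List.Relation.Binary.BagAndSetEquality using (∼bag⇒↭)
open import Data.List.Relation.Binary.Permutation.Propositional using (_↭_)
open import Data.List.Relation.Binary.Permutation.Propositional.Properties using (map⁺)
open import Data.List.Relation.Unary.All using (All; []; _∷_; reduce; tabulate)
open import Data.List.Relation.Unary.All.Properties using (all-filter)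
open import Data.List.Relation.Unary.Any using (here; there)
open import Data.List.Relation.Unary.Unique.Propositional using (Unique; []; _∷_)
open import Data.List.Relation.Unary.Unique.Propositional.Properties using (filter⁺)
open import Data.Nat.Base
  using (zero; suc; pred; _+_; _∸_; _<_; z≤n; s≤s; NonZero; >-nonZero; >-nonZero⁻¹; parity)
open import Data.Nat.Divisibility using (divides; >⇒∤)
open import Data.Nat.DivMod
  using (_%_; _/_; m%n%n≡m%n; m<n⇒m%n≡m; m≡m%n+[m/n]*n; [m+kn]%n≡m%n; %-distribˡ-+)
open import Data.Nat.ListAction using (sum)
open import Data.Nat.ListAction.Properties using (sum-↭)
open import Data.Nat.Properties
  using ( +-assoc; +-comm; +-identityʳ; *-distribʳ-+; *-monoʳ-≤; m*n≢0; +-cancelˡ-≡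
        ; m<n⇒0<n∸m; m∸n≤m; m+[n∸m]≡n; <⇒≤; <-trans; ≤-<-trans; n<1+n; suc-pred
        ; suc[m]≤n⇒m≤pred[n]; m<m+n )
open import Data.Nat.Tactic.RingSolver using (solve-∀)
open import Data.Parity.Base as ℙ using (Parity; 0ℙ; 1ℙ)
import Data.Parity.Properties as ℙ
open import Data.Product.Base using (∃; _×_; _,_; proj₁; proj₂)
open import Data.Product.Properties using (,-injectiveʳ)
open import Data.Sum.Base using (_⊎_; inj₁; inj₂)
open import Function.Base using (_∘_; _$_)
open import Function.Bundles using (_⇔_; mk⇔; Equivalence)
open import Induction.WellFounded using (Acc; acc)
open import Relation.Binary.PropositionalEquality
  using (_≢_; refl; sym; trans; cong; cong₂; subst; module ≡-Reasoning)
open import Relation.Nullary using (¬_; Dec; yes; no; does; contradiction)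
open import Relation.Nullary.Decidable using (dec-true; dec-false; does-⇔)

-- Zero as a mex, and membership in reduced lists.

mex≡0 : ∀ T → 0 ∉ T → mex T ≡ 0
mex≡0 T 0∉T with mex-exists T
... | zero  , _         = refl
... | suc _ , _ , below = contradiction (below (s≤s z≤n)) 0∉T

mex≢0 : ∀ T → 0 ∈ T → mex T ≢ 0
mex≢0 T 0∈T with mex-exists T
... | zero , 0∉T , _ = λ _ → 0∉T 0∈T
... | suc _ , _      = λ ()

module _ {A B : Set} {Q : A → Set} where

  ∈-reduce⁻ : (f : ∀ {x} → Q x → B) → ∀ {xs} (qs : All Q xs) {y} →
              y ∈ reduce f qs → ∃ λ x → ∃ λ (q : Q x) → y ≡ f q
  ∈-reduce⁻ f (q ∷ qs) (here y≡)  = _ , q , y≡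
  ∈-reduce⁻ f (q ∷ qs) (there y∈) = ∈-reduce⁻ f qs y∈

  ∈-reduce⁺ : (f : ∀ {x} → Q x → B) → ∀ {xs} (qs : All Q xs) {x} →
              x ∈ xs → ∃ λ (q : Q x) → f q ∈ reduce f qs
  ∈-reduce⁺ f (q ∷ qs) (here refl) = q , here refl
  ∈-reduce⁺ f (q ∷ qs) (there x∈) with ∈-reduce⁺ f qs x∈
  ... | q′ , fq′∈ = q′ , there fq′∈

-- Reply strategies and single moves on an arbitrary graph.

module _ (G : Graph) where
  open Graph G
  open Toggle G hiding (Position; nimber)

  module _ (Balanced : Position G → Set)
           (reply : ∀ {S v} → Balanced S → Legal S v →
                    ∃ λ w → Legal (switch S v) w × Balanced (switch (switch S v) w))
    where

    mutual
      -- Every option has a reply back into `Balanced`, where the nimber is 0 by recursion. So no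
      -- option has nimber 0. The accessibility proof is arbitrary because each option carries its
      -- own `rec (move legal)`.
      balanced⇒nimber-acc≡0 : ∀ {S} → Balanced S → (a : Acc _≺_ S) → nimber-acc S a ≡ 0
      balanced⇒nimber-acc≡0 {S} bal (acc rec) = mex≡0 _ λ 0∈T →
        let v , legal , 0≡ = ∈-reduce⁻ _ (all-filter (legal? S) vertices) 0∈T
            w , legal′ , bal′ = reply bal legal
        in move⇒nimber-acc≢0 legal′ bal′ (rec (move legal)) (sym 0≡)

      move⇒nimber-acc≢0 : ∀ {S v} → Legal S v → Balanced (switch S v) →
                          (a : Acc _≺_ S) → nimber-acc S a ≢ 0
      move⇒nimber-acc≢0 {S} {v} legal bal (acc rec) =
        let f = λ {u} (l : Legal S u) → nimber-acc (switch S u) (rec (move l))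
            -- The list of options is built from the legality proofs inside `all-filter`, so
            -- `legal′` from there replaces the given `legal`.
            legal′ , f∈T = ∈-reduce⁺ f (all-filter (legal? S) vertices)
                             (∈-filter⁺ (legal? S) (complete v) legal)
        in mex≢0 _ (subst (_∈ _) (balanced⇒nimber-acc≡0 bal (rec (move legal′))) f∈T)

    balanced⇒nimber≡0 : ∀ {S} → Balanced S → nimber G S ≡ 0
    balanced⇒nimber≡0 {S} bal = balanced⇒nimber-acc≡0 bal (≺-wellFounded S)

  switch-inside : ∀ S v {u} → u ∈N[ v ] → switch S v u ≡ not (S u)
  switch-inside S v {u} u∈N rewrite dec-true (u ∈N[ v ]?) u∈N = refl

  switch-outside : ∀ S v {u} → ¬ u ∈N[ v ] → switch S v u ≡ S u
  switch-outside S v {u} u∉N rewrite dec-false (u ∈N[ v ]?) u∉N = refl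

  -- Two duplicate-free lists with the same members are permutations of each other. This trades the
  -- filtered enumeration for an explicit list on which `σ` computes.
  N-↭ : ∀ {v ns} → Unique ns → (∀ {u} → u ∈N[ v ] ⇔ u ∈ ns) → N[ v ] ↭ ns
  N-↭ {v} uniq N⇔ = ∼bag⇒↭ $ unique∧set⇒bag (filter⁺ (_∈N[ v ]?) unique) uniq $ mk⇔
    (λ u∈ → to (proj₂ (∈-filter⁻ (_∈N[ v ]?) {xs = vertices} u∈)))
    (λ u∈ → ∈-filter⁺ (_∈N[ v ]?) (complete _) (from u∈))
    where open module N⇔ {u} = Equivalence (N⇔ {u})

  σ-switch : ∀ S v → σ (switch S v) v ≡ sum (map (weight (not ∘ S)) N[ v ])
  σ-switch S v = cong sum $ map-cong-local $ tabulate λ u∈ →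
    cong (λ b → if b then 0 else 1)
         (switch-inside S v (proj₂ (∈-filter⁻ (_∈N[ v ]?) {xs = vertices} u∈)))

  module _ {v a b c} (N↭ : N[ v ] ↭ v ∷ a ∷ b ∷ c ∷ []) where

    private
      ns : List Vertex
      ns = v ∷ a ∷ b ∷ c ∷ []

      σ-ns : ∀ S → σ S v ≡ sum (map (weight S) ns)
      σ-ns S = sum-↭ (map⁺ (weight S) N↭)

      σ-switch-ns : ∀ S → σ (switch S v) v ≡ sum (map (weight (not ∘ S)) ns)
      σ-switch-ns S = trans (σ-switch S v) (sum-↭ (map⁺ (weight (not ∘ S)) N↭))

    -- The weight sum drops from 3 to 1.
    legal⁺ : ∀ {S} → S v ≡ false → S a ≡ false → S b ≡ false → S c ≡ true → Legal S v
    legal⁺ {S} Sv Sa Sb Sc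
      rewrite σ-ns S | σ-switch-ns S | Sv | Sa | Sb | Sc = refl , s≤s (s≤s z≤n)

    -- On four vertices a switch turns the sum `s` into `4 - s`, so legality forces `s` to be at
    -- least 3. With `c` off, the other three must all be on.
    legal⁻ : ∀ {S} → Legal S v → S c ≡ true → S a ≡ false × S b ≡ false
    legal⁻ {S} (wv , σ<) Sc
      rewrite σ-ns S | σ-switch-ns S | Sc with S v | S a | S b
    ... | false | false | false = refl , refl
    legal⁻ (() , _) _ | true  | _     | _
    legal⁻ (_ , s≤s (s≤s ())) _ | false | true  | false
    legal⁻ (_ , s≤s (s≤s ())) _ | false | false | true
    legal⁻ (_ , s≤s ()) _ | false | true  | true

weight≡1⇒on : ∀ {b : Bool} → (if b then 0 else 1) ≡ 1 → b ≡ false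
weight≡1⇒on {false} _ = refl

-- Arithmetic of cyclic shifts.

module Rotation (m : ℕ) .{{_ : NonZero m}} where

  toℕ-⊕ : ∀ (i : Fin m) a → toℕ (i ⊕ a) ≡ (toℕ i + a) % m
  toℕ-⊕ i a = toℕ-fromℕ< _

  ⊕-assoc : ∀ (i : Fin m) a b → (i ⊕ a) ⊕ b ≡ i ⊕ (a + b)
  ⊕-assoc i a b = toℕ-injective $ begin
    toℕ ((i ⊕ a) ⊕ b)                      ≡⟨ toℕ-⊕ (i ⊕ a) b ⟩
    (toℕ (i ⊕ a) + b) % m                  ≡⟨ cong (λ x → (x + b) % m) (toℕ-⊕ i a) ⟩
    ((toℕ i + a) % m + b) % m              ≡⟨ %-distribˡ-+ ((toℕ i + a) % m) b m ⟩
    ((toℕ i + a) % m % m + b % m) % m      ≡⟨ cong (λ x → (x + b % m) % m) (m%n%n≡m%n (toℕ i + a) m) ⟩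
    ((toℕ i + a) % m + b % m) % m          ≡⟨ %-distribˡ-+ (toℕ i + a) b m ⟨
    (toℕ i + a + b) % m                    ≡⟨ cong (_% m) (+-assoc (toℕ i) a b) ⟩
    (toℕ i + (a + b)) % m                  ≡⟨ toℕ-⊕ i (a + b) ⟨
    toℕ (i ⊕ (a + b))                      ∎
    where open ≡-Reasoning

  ⊕-multiple : ∀ (i : Fin m) t → i ⊕ (t * m) ≡ i
  ⊕-multiple i t = toℕ-injective $
    trans (toℕ-⊕ i (t * m)) (trans ([m+kn]%n≡m%n (toℕ i) t m) (m<n⇒m%n≡m (toℕ<n i)))

  ⊕-period : ∀ (i : Fin m) {a} → a ≡ m → i ⊕ a ≡ i
  ⊕-period i a≡m = trans (cong (i ⊕_) (trans a≡m (sym (+-identityʳ m)))) (⊕-multiple i 1)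

  ⊕-swap : ∀ (i : Fin m) a b → (i ⊕ a) ⊕ b ≡ (i ⊕ b) ⊕ a
  ⊕-swap i a b = trans (⊕-assoc i a b) (trans (cong (i ⊕_) (+-comm a b)) (sym (⊕-assoc i b a)))

  ⊕-inverse : ∀ (i : Fin m) {a b} → a + b ≡ m → (i ⊕ a) ⊕ b ≡ i
  ⊕-inverse i {a} {b} a+b≡m = trans (⊕-assoc i a b) (⊕-period i a+b≡m)

  -- If the shift fixed `i`, cancelling `toℕ i` in the division of `toℕ i + a` by `m` would leave
  -- `a` as a multiple of `m`.
  ⊕-moves : ∀ (i : Fin m) {a} → 0 < a → a < m → i ≢ i ⊕ a
  ⊕-moves i {a} 0<a a<m i≡ = >⇒∤ a<m (divides ((toℕ i + a) / m) a≡)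
    where
    instance _ = >-nonZero 0<a
    a≡ : a ≡ (toℕ i + a) / m * m
    a≡ = +-cancelˡ-≡ (toℕ i) _ _ $ trans (m≡m%n+[m/n]*n (toℕ i + a) m)
      (cong (_+ (toℕ i + a) / m * m) (sym (trans (cong toℕ i≡) (toℕ-⊕ i a))))

  ⊕-distinct : ∀ (i : Fin m) {a b} → a < b → b < m → i ⊕ a ≢ i ⊕ b
  ⊕-distinct i {a} {b} a<b b<m eq =
    ⊕-moves (i ⊕ a) (m<n⇒0<n∸m a<b) (≤-<-trans (m∸n≤m b a) b<m)
      (trans eq (sym (trans (⊕-assoc i a (b ∸ a)) (cong (i ⊕_) (m+[n∸m]≡n (<⇒≤ a<b))))))

  index-parity : Fin m → Parity
  index-parity i = parity (toℕ i)

  -- Reduction modulo `m` removes a multiple of an even number, which keeps the parity.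
  index-parity-⊕ : parity m ≡ 0ℙ → ∀ (i : Fin m) a →
                   index-parity (i ⊕ a) ≡ index-parity i ℙ.+ parity a
  index-parity-⊕ even i a = begin
    parity (toℕ (i ⊕ a))                     ≡⟨ cong parity (toℕ-⊕ i a) ⟩
    parity (x % m)                           ≡⟨ ℙ.+-identityʳ _ ⟨
    parity (x % m) ℙ.+ 0ℙ                    ≡⟨ cong (parity (x % m) ℙ.+_) even′ ⟨
    parity (x % m) ℙ.+ parity (x / m * m)    ≡⟨ ℙ.+-homo-+ (x % m) (x / m * m) ⟨
    parity (x % m + x / m * m)               ≡⟨ cong parity (m≡m%n+[m/n]*n x m) ⟨
    parity (toℕ i + a)                       ≡⟨ ℙ.+-homo-+ (toℕ i) a ⟩
    parity (toℕ i) ℙ.+ parity a              ∎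
    where
    open ≡-Reasoning
    x = toℕ i + a
    even′ : parity (x / m * m) ≡ 0ℙ
    even′ = trans (ℙ.*-homo-* (x / m) m)
      (trans (cong (parity (x / m) ℙ.*_) even) (ℙ.*-zeroʳ (parity (x / m))))

-- Triangles and closed neighbourhoods.

pattern inner i = zero , i
pattern outer i = suc zero , i

module Petersen (k : ℕ) .{{_ : NonZero k}} (k-even : parity k ≡ 0ℙ) where

  m : ℕ
  m = 3 * k

  instance
    m-nonZero : NonZero m
    m-nonZero = m*n≢0 3 k

  m-even : parity m ≡ 0ℙ
  m-even = trans (ℙ.*-homo-* 3 k) k-even

  open Rotation m
  open Toggle (P m k) hiding (Position; nimber)

  0<k : 0 < k
  0<k = >-nonZero⁻¹ k

  k<2k : k < 2 * k
  k<2k = m<m+n k (subst (0 <_) (sym (+-identityʳ k)) 0<k)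

  2k<m : 2 * k < m
  2k<m = subst (2 * k <_) (+-comm (2 * k) k) (m<m+n (2 * k) 0<k)

  1+pred : 1 + pred m ≡ m
  1+pred = suc-pred m

  -- Holds since `m` is at least 3. It keeps the two cycle neighbours of an outer vertex apart.
  1<pred : 1 < pred m
  1<pred = suc[m]≤n⇒m≤pred[n] (*-monoʳ-≤ 3 0<k)

  pred<m : pred m < m
  pred<m = subst (pred m <_) 1+pred (n<1+n (pred m))

  -- i ∼ j: the inner vertices i and j lie on the same triangle.
  _∼_ : Fin m → Fin m → Set
  i ∼ j = ∃ λ t → j ≡ i ⊕ (t * k)

  ∼-refl : ∀ {i} → i ∼ i
  ∼-refl {i} = 0 , sym (⊕-multiple i 0)

  ∼-trans : ∀ {i j l} → i ∼ j → j ∼ l → i ∼ l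
  ∼-trans {i} (s , refl) (t , refl) =
    s + t , trans (⊕-assoc i (s * k) (t * k)) (cong (i ⊕_) (sym (*-distribʳ-+ k s t)))

  -- Going back `t` steps without subtraction: `t * 2` further steps complete `t` full turns.
  ∼-sym : ∀ {i j} → i ∼ j → j ∼ i
  ∼-sym {i} (t , refl) = t * 2 , sym (begin
    (i ⊕ (t * k)) ⊕ (t * 2 * k)    ≡⟨ ⊕-assoc i (t * k) (t * 2 * k) ⟩
    i ⊕ (t * k + t * 2 * k)        ≡⟨ cong (i ⊕_) (multiple-of-3k t k) ⟩
    i ⊕ (t * (3 * k))              ≡⟨ ⊕-multiple i t ⟩
    i                              ∎)
    where
    open ≡-Reasoning
    multiple-of-3k : ∀ t k → t * k + t * 2 * k ≡ t * (3 * k)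
    multiple-of-3k = solve-∀

  ∼-shift : ∀ i → i ∼ (i ⊕ k)
  ∼-shift i = 1 , cong (i ⊕_) (sym (+-identityʳ k))

  triangle : ∀ {i j} → i ∼ j → j ≡ i ⊎ j ≡ i ⊕ k ⊎ j ≡ i ⊕ (2 * k)
  triangle {i} {j} (t , j≡) = reduce-mod-3 t j≡
    where
    open ≡-Reasoning
    reduce-mod-3 : ∀ t → j ≡ i ⊕ (t * k) → j ≡ i ⊎ j ≡ i ⊕ k ⊎ j ≡ i ⊕ (2 * k)
    reduce-mod-3 0 j≡ = inj₁ (trans j≡ (⊕-multiple i 0))
    reduce-mod-3 1 j≡ = inj₂ (inj₁ (trans j≡ (cong (i ⊕_) (+-identityʳ k))))
    reduce-mod-3 2 j≡ = inj₂ (inj₂ j≡)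
    reduce-mod-3 (suc (suc (suc t))) j≡ = reduce-mod-3 t (begin
      j                          ≡⟨ j≡ ⟩
      i ⊕ ((3 + t) * k)          ≡⟨ cong (i ⊕_) (*-distribʳ-+ k 3 t) ⟩
      i ⊕ (3 * k + t * k)        ≡⟨ ⊕-assoc i (3 * k) (t * k) ⟨
      (i ⊕ (3 * k)) ⊕ (t * k)    ≡⟨ cong (_⊕ (t * k)) (⊕-period i refl) ⟩
      i ⊕ (t * k)                ∎)

  -- Since `k` is even, steps along a triangle keep the parity. This is what lets parity tell paired
  -- triangles apart.
  index-parity-∼ : ∀ {i j} → i ∼ j → index-parity j ≡ index-parity i
  index-parity-∼ {i} (t , refl) = begin
    index-parity (i ⊕ (t * k))            ≡⟨ index-parity-⊕ m-even i (t * k) ⟩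
    index-parity i ℙ.+ parity (t * k)     ≡⟨ cong (index-parity i ℙ.+_) tk-even ⟩
    index-parity i ℙ.+ 0ℙ                 ≡⟨ ℙ.+-identityʳ _ ⟩
    index-parity i                        ∎
    where
    open ≡-Reasoning
    tk-even : parity (t * k) ≡ 0ℙ
    tk-even = trans (ℙ.*-homo-* t k)
      (trans (cong (parity t ℙ.*_) k-even) (ℙ.*-zeroʳ (parity t)))

  inner-inner : ∀ {i j} → inner j ∈N[ inner i ] ⇔ i ∼ j
  inner-inner {i} {j} = mk⇔ to from
    where
    to : inner j ∈N[ inner i ] → i ∼ j
    to (inj₁ refl)               = ∼-refl
    to (inj₂ (_ , inj₁ refl))    = ∼-shift i
    to (inj₂ (_ , inj₂ refl))    = ∼-sym (∼-shift j)

    from : i ∼ j → inner j ∈N[ inner i ]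
    from i∼j with triangle i∼j
    ... | inj₁ refl        = inj₁ refl
    ... | inj₂ (inj₁ refl) =
      inj₂ ((λ eq → ⊕-moves i 0<k (<-trans k<2k 2k<m) (,-injectiveʳ eq)) , inj₁ refl)
    -- The edge is traversed backwards: one step of `k` from `i ⊕ (2 * k)` returns to `i`.
    ... | inj₂ (inj₂ refl) =
      inj₂ ((λ eq → ⊕-moves i (<-trans 0<k k<2k) 2k<m (,-injectiveʳ eq)) ,
            inj₂ (sym (⊕-inverse i (+-comm (2 * k) k))))

  inner-outer : ∀ {i j} → outer j ∈N[ inner i ] ⇔ j ≡ i
  inner-outer = mk⇔ (λ { (inj₂ (_ , inj₁ j≡i)) → j≡i })
                    (λ j≡i → inj₂ ((λ ()) , inj₁ j≡i))

  module II {i j} = Equivalence (inner-inner {i} {j})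
  module IO {i j} = Equivalence (inner-outer {i} {j})

  -- The outer neighbour comes last, to fill the slot `c` of `legal⁺`.
  inner-N : ∀ i → N[ inner i ] ↭
            inner i ∷ inner (i ⊕ k) ∷ inner (i ⊕ (2 * k)) ∷ outer i ∷ []
  inner-N i = N-↭ (P m k) uniq (mk⇔ to from)
    where
    uniq : Unique _
    uniq = ((⊕-moves i 0<k (<-trans k<2k 2k<m) ∘ ,-injectiveʳ)
             ∷ (⊕-moves i (<-trans 0<k k<2k) 2k<m ∘ ,-injectiveʳ) ∷ (λ ()) ∷ [])
         ∷ ((⊕-distinct i k<2k 2k<m ∘ ,-injectiveʳ) ∷ (λ ()) ∷ [])
         ∷ ((λ ()) ∷ []) ∷ [] ∷ []

    to : ∀ {u} → u ∈N[ inner i ] → u ∈ _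
    to {inner j} u∈ with triangle (II.to u∈)
    ... | inj₁ refl        = here refl
    ... | inj₂ (inj₁ refl) = there (here refl)
    ... | inj₂ (inj₂ refl) = there (there (here refl))
    to {outer j} u∈ with refl ← IO.to {i} u∈ = there (there (there (here refl)))

    from : ∀ {u} → u ∈ _ → u ∈N[ inner i ]
    from (here refl)                         = inj₁ refl
    from (there (here refl))                 = II.from (∼-shift i)
    from (there (there (here refl)))         = II.from (2 , refl)
    from (there (there (there (here refl)))) = IO.from refl

  -- Here `i ⊕ pred m` is the index before `i`. The inner neighbour fills the slot `c` of `legal⁻`.
  outer-N : ∀ i → N[ outer i ] ↭
            outer i ∷ outer (i ⊕ 1) ∷ outer (i ⊕ pred m) ∷ inner i ∷ []
  outer-N i = N-↭ (P m k) uniq (mk⇔ to from)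
    where
    i≢i+1 : i ≢ i ⊕ 1
    i≢i+1 = ⊕-moves i (s≤s z≤n) (<-trans 1<pred pred<m)
    i≢i-1 : i ≢ i ⊕ pred m
    i≢i-1 = ⊕-moves i (<-trans (s≤s z≤n) 1<pred) pred<m

    uniq : Unique _
    uniq = ((i≢i+1 ∘ ,-injectiveʳ) ∷ (i≢i-1 ∘ ,-injectiveʳ) ∷ (λ ()) ∷ [])
         ∷ ((⊕-distinct i 1<pred pred<m ∘ ,-injectiveʳ) ∷ (λ ()) ∷ [])
         ∷ ((λ ()) ∷ []) ∷ [] ∷ []

    to : ∀ {u} → u ∈N[ outer i ] → u ∈ _
    to (inj₁ refl)                         = here refl
    to {outer j} (inj₂ (_ , inj₁ refl))    = there (here refl)
    to {outer j} (inj₂ (_ , inj₂ refl))    =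
      there (there (here (cong (suc zero ,_) (sym (⊕-inverse j 1+pred)))))
    to {inner j} (inj₂ (_ , inj₂ refl))    = there (there (there (here refl)))

    from : ∀ {u} → u ∈ _ → u ∈N[ outer i ]
    from (here refl)                         = inj₁ refl
    from (there (here refl))                 = inj₂ (i≢i+1 ∘ ,-injectiveʳ , inj₁ refl)
    from (there (there (here refl)))         =
      inj₂ (i≢i-1 ∘ ,-injectiveʳ , inj₂ (sym (⊕-inverse i (trans (+-comm (pred m) 1) 1+pred))))
    from (there (there (there (here refl)))) = inj₂ ((λ ()) , inj₂ refl)

  -- The pairing of consecutive indices.

  partner-step : Parity → ℕ
  partner-step 0ℙ = 1
  partner-step 1ℙ = pred m

  -- Even indices go one forward and odd ones one back, as `pred m` acts as -1. The step depends on
  -- the parity alone, so indices of equal parity are rotated alike.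
  partner : Fin m → Fin m
  partner i = i ⊕ partner-step (index-parity i)

  parity-partner-step : ∀ p → parity (partner-step p) ≡ 1ℙ
  parity-partner-step 0ℙ = refl
  parity-partner-step 1ℙ = begin
    parity (pred m)             ≡⟨ ℙ.suc-homo-⁻¹ (pred m) ⟨
    parity (suc (pred m)) ℙ.⁻¹  ≡⟨ cong (λ x → parity x ℙ.⁻¹) 1+pred ⟩
    parity m ℙ.⁻¹               ≡⟨ cong ℙ._⁻¹ m-even ⟩
    1ℙ                          ∎
    where open ≡-Reasoning

  index-parity-partner : ∀ i → index-parity (partner i) ≡ index-parity i ℙ.⁻¹
  index-parity-partner i = begin
    index-parity (partner i)                                  ≡⟨ index-parity-⊕ m-even i _ ⟩
    index-parity i ℙ.+ parity (partner-step (index-parity i)) ≡⟨ cong (index-parity i ℙ.+_) (parity-partner-step (index-parity i)) ⟩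
    index-parity i ℙ.+ 1ℙ                                     ≡⟨ ℙ.+-comm (index-parity i) 1ℙ ⟩
    index-parity i ℙ.⁻¹                                       ∎
    where open ≡-Reasoning

  -- The first step flips the parity, so the second is the opposite step, and together they make a
  -- full turn.
  partner-involutive : ∀ i → partner (partner i) ≡ i
  partner-involutive i = trans
    (cong (λ p → partner i ⊕ partner-step p) (index-parity-partner i))
    (⊕-inverse i (steps (index-parity i)))
    where
    steps : ∀ p → partner-step p + partner-step (p ℙ.⁻¹) ≡ m
    steps 0ℙ = 1+pred
    steps 1ℙ = trans (+-comm (pred m) 1) 1+pred

  partner-swap : ∀ i {j} → partner i ≡ j → partner j ≡ i
  partner-swap i refl = partner-involutive i

  -- Parity is constant on a triangle, so `partner` rotates all of it by the same step: the pairing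
  -- descends to triangles.
  partner-∼ : ∀ {i j} → i ∼ j → partner i ∼ partner j
  partner-∼ {i} i∼j@(t , refl) = t , (begin
    (i ⊕ (t * k)) ⊕ partner-step (index-parity (i ⊕ (t * k)))  ≡⟨ cong (λ p → (i ⊕ (t * k)) ⊕ partner-step p) (index-parity-∼ i∼j) ⟩
    (i ⊕ (t * k)) ⊕ partner-step (index-parity i)            ≡⟨ ⊕-swap i (t * k) _ ⟩
    partner i ⊕ (t * k)                                      ∎)
    where open ≡-Reasoning

  partner-shift : ∀ i → partner (i ⊕ k) ≡ partner i ⊕ k
  partner-shift i = begin
    (i ⊕ k) ⊕ partner-step (index-parity (i ⊕ k))   ≡⟨ cong (λ p → (i ⊕ k) ⊕ partner-step p) (index-parity-∼ (∼-shift i)) ⟩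
    (i ⊕ k) ⊕ partner-step (index-parity i)         ≡⟨ ⊕-swap i k _ ⟩
    partner i ⊕ k                                   ∎
    where open ≡-Reasoning

  -- `partner` flips the parity, which is constant on a triangle. Hence the reply finds a triangle
  -- untouched by the move.
  ≁-partner : ∀ {i} → ¬ i ∼ partner i
  ≁-partner {i} i∼ = ℙ.p≢p⁻¹ (index-parity i)
    (trans (sym (index-parity-∼ i∼)) (index-parity-partner i))

  -- Balanced positions.

  -- Pitfall: true marks weight 0, so S u ≡ false says that u is on.
  record Balanced (S : Position (P m k)) : Set where
    field
      shifted : ∀ i → S (inner (i ⊕ k)) ≡ S (inner i)
      paired  : ∀ i → S (inner (partner i)) ≡ S (inner i)
      fresh   : ∀ {i} → S (inner i) ≡ false → S (outer i) ≡ true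
      split   : ∀ {i} → S (outer i) ≡ false → S (outer (partner i)) ≡ true

    constant : ∀ {i j} → i ∼ j → S (inner j) ≡ S (inner i)
    constant i∼j with triangle i∼j
    ... | inj₁ refl        = refl
    ... | inj₂ (inj₁ refl) = shifted _
    -- One more shift by `k` completes the turn back to `i`.
    ... | inj₂ (inj₂ refl) = trans (sym (shifted _))
      (cong (S ∘ (zero ,_)) (⊕-inverse _ (+-comm (2 * k) k)))

  𝒫₁₀-balanced : Balanced (𝒫₁₀ m k)
  𝒫₁₀-balanced = record
    { shifted = λ _ → refl
    ; paired  = λ _ → refl
    ; fresh   = λ _ → refl
    ; split   = λ _ → refl
    }

  -- Playing `partner i` itself would leave two partners on together in the outer cycle. The shift
  -- by `k` uses up the same triangle but turns on another outer vertex.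
  response : Fin m → Fin m
  response i = partner i ⊕ k

  -- Illegal outer moves, and the effect of a reply.

  module _ {S} (bal : Balanced S) where
    open Balanced bal

    -- If the inner neighbour is on, `fresh` says that the outer vertex is off. Otherwise both cycle
    -- neighbours must be on; one is the partner, against `split`.
    outer-illegal : ∀ i → ¬ Legal S (outer i)
    outer-illegal i legal@(w≡1 , _) with S (inner i) in Si
    ... | false = contradiction (trans (sym (fresh Si)) (weight≡1⇒on w≡1)) λ ()
    ... | true  = contradiction (trans (sym (split (weight≡1⇒on w≡1))) partner-on) λ ()
      where
      sides-on : S (outer (i ⊕ 1)) ≡ false × S (outer (i ⊕ pred m)) ≡ false
      sides-on = legal⁻ (P m k) (outer-N i) {S} legal Si

      side-on : ∀ p → S (outer (i ⊕ partner-step p)) ≡ false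
      side-on 0ℙ = proj₁ sides-on
      side-on 1ℙ = proj₂ sides-on

      partner-on : S (outer (partner i)) ≡ false
      partner-on = side-on (index-parity i)

    module _ {i} (Si : S (inner i) ≡ false) where

      private
        j : Fin m
        j = response i

        S′ S″ : Position (P m k)
        S′ = switch S (inner i)
        S″ = switch S′ (inner j)

        partner∼j : partner i ∼ j
        partner∼j = ∼-shift (partner i)

        ≁j : ∀ {l} → i ∼ l → ¬ j ∼ l
        ≁j i∼l j∼l = ≁-partner (∼-trans i∼l (∼-sym (∼-trans partner∼j j∼l)))

        on-j : ∀ {l} → j ∼ l → S (inner l) ≡ false
        on-j j∼l = trans (constant (∼-trans partner∼j j∼l)) (trans (paired i) Si)

        on-i : ∀ {l} → i ∼ l → S (inner l) ≡ false
        on-i i∼l = trans (constant i∼l) Si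

        inner-S′ : ∀ {l} → j ∼ l → S′ (inner l) ≡ false
        inner-S′ j∼l = trans
          (switch-outside (P m k) S (inner i) (λ l∈ → ≁j (II.to l∈) j∼l)) (on-j j∼l)

        outer-S′ : ∀ {l} → l ≢ i → S′ (outer l) ≡ S (outer l)
        outer-S′ l≢i = switch-outside (P m k) S (inner i) (l≢i ∘ IO.to)

        outer-S″ : ∀ {l} → l ≢ i → l ≢ j → S″ (outer l) ≡ S (outer l)
        outer-S″ l≢i l≢j = trans
          (switch-outside (P m k) S′ (inner j) (l≢j ∘ IO.to)) (outer-S′ l≢i)

        j≢i : j ≢ i
        j≢i j≡i = ≁j ∼-refl (subst (j ∼_) j≡i ∼-refl)

      -- By `paired` the triangle of `j` was on, and the first move did not reach it. The outer
      -- vertex `j` is still off by `fresh`, as `j` differs from `i`.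
      response-legal : Legal S′ (inner j)
      response-legal = legal⁺ (P m k) (inner-N j) {S′}
        (inner-S′ ∼-refl) (inner-S′ (∼-shift j)) (inner-S′ (2 , refl))
        (trans (outer-S′ j≢i) (fresh (on-j ∼-refl)))

      private
        -- One switch seen at a single vertex: on inner vertices `S″` unfolds to two nested flips of
        -- `S`.
        flip : Bool → Bool → Bool
        flip d b = if d then not b else b

        flip-comm : ∀ c d b → flip c (flip d b) ≡ flip d (flip c b)
        flip-comm false d     b = refl
        flip-comm true  false b = refl
        flip-comm true  true  b = refl

        in-N : Fin m → Fin m → Bool
        in-N a l = does (inner l ∈N[ inner a ]?)

        in-N-cong : ∀ {a b l l′} → (a ∼ l → b ∼ l′) → (b ∼ l′ → a ∼ l) → in-N a l ≡ in-N b l′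
        in-N-cong {a} {b} {l} {l′} f g = does-⇔ (mk⇔ (II.from ∘ f ∘ II.to) (II.from ∘ g ∘ II.to))
          (inner l ∈N[ inner a ]?) (inner l′ ∈N[ inner b ]?)

        in-N-shift : ∀ a l → in-N a (l ⊕ k) ≡ in-N a l
        in-N-shift a l = in-N-cong (λ h → ∼-trans h (∼-sym (∼-shift l)))
                                   (λ h → ∼-trans h (∼-shift l))

        partner-flip : ∀ {a l} → a ∼ partner l → partner a ∼ l
        partner-flip {a} {l} h = subst (partner a ∼_) (partner-involutive l) (partner-∼ h)

        partner-flip′ : ∀ {a l} → partner a ∼ l → a ∼ partner l
        partner-flip′ {a} h = subst (_∼ _) (partner-involutive a) (partner-∼ h)

        in-N-partner-i : ∀ l → in-N i (partner l) ≡ in-N j l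
        in-N-partner-i l = in-N-cong (λ h → ∼-trans (∼-sym partner∼j) (partner-flip h))
                                     (λ h → partner-flip′ (∼-trans partner∼j h))

        in-N-partner-j : ∀ l → in-N j (partner l) ≡ in-N i l
        in-N-partner-j l = in-N-cong
          (λ h → subst (_∼ l) (partner-involutive i) (partner-flip (∼-trans partner∼j h)))
          (λ h → ∼-trans (∼-sym partner∼j) (partner-∼ h))

        shifted″ : ∀ l → S″ (inner (l ⊕ k)) ≡ S″ (inner l)
        shifted″ l = cong₂ flip (in-N-shift j l) (cong₂ flip (in-N-shift i l) (shifted l))

        -- Passing to the partner exchanges the triangles of `i` and `j`, hence the two flips, and
        -- flips commute.
        paired″ : ∀ l → S″ (inner (partner l)) ≡ S″ (inner l)
        paired″ l = trans
          (cong₂ flip (in-N-partner-j l) (cong₂ flip (in-N-partner-i l) (paired l)))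
          (flip-comm (in-N i l) (in-N j l) (S (inner l)))

        off-i : ∀ {l} → i ∼ l → S″ (inner l) ≡ true
        off-i i∼l = trans
          (switch-outside (P m k) S′ (inner j) (≁j i∼l ∘ II.to))
          (trans (switch-inside (P m k) S (inner i) (II.from i∼l)) (cong not (on-i i∼l)))

        off-j : ∀ {l} → j ∼ l → S″ (inner l) ≡ true
        off-j j∼l = trans
          (switch-inside (P m k) S′ (inner j) (II.from j∼l)) (cong not (inner-S′ j∼l))

        -- Both played triangles are now off, so `l` lies on neither. Then neither the inner nor the
        -- outer vertex `l` has changed.
        fresh″ : ∀ {l} → S″ (inner l) ≡ false → S″ (outer l) ≡ true
        fresh″ {l} on with inner l ∈N[ inner i ]? | inner l ∈N[ inner j ]?
        ... | yes l∈i | _ = contradiction (trans (sym on) (off-i (II.to l∈i))) λ ()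
        ... | no _ | yes l∈j = contradiction (trans (sym on) (off-j (II.to l∈j))) λ ()
        ... | no l∉i | no l∉j = trans
          (outer-S″ (λ { refl → l∉i (II.from ∼-refl) }) (λ { refl → l∉j (II.from ∼-refl) }))
          (fresh (trans (sym unchanged) on))
          where
          unchanged : S″ (inner l) ≡ S (inner l)
          unchanged = trans (switch-outside (P m k) S′ (inner j) l∉j)
                            (switch-outside (P m k) S (inner i) l∉i)

        i∼partner-j : i ∼ partner j
        i∼partner-j = partner-flip′ partner∼j

        -- The partner of `j` is `i ⊕ k`. This is where the shift in `response` pays off.
        partner-j≢i : partner j ≢ i
        partner-j≢i eq = ⊕-moves i 0<k (<-trans k<2k 2k<m) (begin
          i                       ≡⟨ eq ⟨
          partner (partner i ⊕ k) ≡⟨ partner-shift (partner i) ⟩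
          partner (partner i) ⊕ k ≡⟨ cong (_⊕ k) (partner-involutive i) ⟩
          i ⊕ k                   ∎)
          where
          open ≡-Reasoning

        off-partner-i : S (outer (partner i)) ≡ true
        off-partner-i = fresh (trans (paired i) Si)

        off-partner-j : S (outer (partner j)) ≡ true
        off-partner-j = fresh (on-i i∼partner-j)

        partner≢ : ∀ {l} → partner l ≢ l
        partner≢ {l} eq = ≁-partner (subst (l ∼_) (sym eq) ∼-refl)

        -- Only the outer vertices `i` and `j` are newly on. Their partners were off by `fresh` and
        -- were not switched. Any other `l` that is on was on before, so its partner is neither `i`
        -- nor `j`, and `split` carries over.
        split″ : ∀ {l} → Dec (l ≡ i) → Dec (l ≡ j) →
                 S″ (outer l) ≡ false → S″ (outer (partner l)) ≡ true
        split″ (yes refl) _ _ = trans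
          (outer-S″ partner≢ (partner-j≢i ∘ partner-swap i)) off-partner-i
        split″ (no _) (yes refl) _ = trans (outer-S″ partner-j≢i partner≢) off-partner-j
        split″ {l} (no l≢i) (no l≢j) on = trans
          (outer-S″ (l≢partner off-partner-i) (l≢partner off-partner-j)) (split was-on)
          where
          was-on : S (outer l) ≡ false
          was-on = trans (sym (outer-S″ l≢i l≢j)) on
          l≢partner : ∀ {a} → S (outer (partner a)) ≡ true → partner l ≢ a
          l≢partner off refl = contradiction
            (trans (sym was-on) (subst (λ x → S (outer x) ≡ true) (partner-involutive l) off))
            λ ()

      response-balanced : Balanced S″
      response-balanced = record
        { shifted = shifted″ ; paired = paired″ ; fresh = λ {l} → fresh″ {l}
        ; split = λ {l} → split″ {l} (l ≟ i) (l ≟ j) }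

  -- The pairing strategy and the resulting nimber.

  reply : ∀ {S v} → Balanced S → Legal S v →
          ∃ λ w → Legal (switch S v) w × Balanced (switch (switch S v) w)
  reply {v = inner i} bal (w≡1 , _) =
    inner (response i) , response-legal bal on , response-balanced bal on
    where on = weight≡1⇒on w≡1
  reply {v = outer i} bal legal = contradiction legal (outer-illegal bal i)

  nimber≡0 : nimber (P m k) (𝒫₁₀ m k) ≡ 0
  nimber≡0 = balanced⇒nimber≡0 (P m k) Balanced reply 𝒫₁₀-balanced

even-parity : ∀ {k} → 2 ∣ k → parity k ≡ 0ℙ
even-parity (divides q refl) = trans (ℙ.*-homo-* q 2) (ℙ.*-zeroʳ (parity q))

theorem4p5 : ∀ (k : ℕ) → k > 0 → 2 ∣ k →
    nimber (P (3 * k) k) (𝒫₁₀ (3 * k) k) ≡ 0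
theorem4p5 k k>0 2∣k = Petersen.nimber≡0 k {{>-nonZero k>0}} (even-parity 2∣k)
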